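{- Let $u, v \in A^*$. Then $u \equiv_{\mathrm{B}} v$ if and only if $\mathsf{P}(u) = \mathsf{P}(v)$.
   Context: $A = \{a_1 < a_2 < \cdots\}$ is a totally ordered infinite alphabet and $A^*$ is the free monoid of words on $A$. A congruence on $A^*$ is an equivalence relation compatible with concatenation. The Baxter congruence $\equiv_{\mathrm{B}}$ is the smallest congruence on $A^*$ such that, for all words $u, v \in A^*$ and letters $a,b,c,d \in A$: $\; c\,u\,a d\,v\,b \equiv_{\mathrm{B}} c\,u\,d a\,v\,b$ whenever $a \leq b < c \leq d$, and $\; b\,u\,d a\,v\,c \equiv_{\mathrm{B}} b\,u\,a d\,v\,c$ whenever $a < b \leq c < d$. A binary tree is either empty (a leaf) or a node with a left and a right binary subtree. A binary tree with nodes labeled by $A$ is a right (resp. left) binary search tree if for every node $x$ labeled by $b$, every label $a$ in the left subtree of $x$ and every label $c$ in the right subtree of $x$, one has $a \leq b < c$ (resp. $a < b \leq c$). The leaf insertion of a letter $a$ into a right (resp. left) binary search tree $T$: if $T$ is empty, return the one-node tree labeled $a$; otherwise, with $b$ the label of the root of $T$, if $a \leq b$ (resp. $a < b$) recursively leaf insert $a$ into the left subtree of $T$, and otherwise recursively leaf insert $a$ into the right subtree. The Baxter $\mathsf{P}$-symbol of $u \in A^*$ is the pair $\mathsf{P}(u) = (T_L, T_R)$ of labeled trees, where $T_L$ (resp. $T_R$) is the left (resp. right) binary search tree obtained by leaf inserting the letters of $u$ from left to right (resp. from right to left), starting from the empty tree. -}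

module Defs where

open import Algebra.Definitions using (Congruent₂)
open import Algebra.Structures using (IsMagma)
open import Data.Bool.Base using (if_then_else_)
open import Data.List.Base using (List; _∷_; _++_; [_]; foldl; foldr)
open import Data.Nat.Base using (ℕ; _≤_; _<_)
open import Data.Nat.Properties using (_≤?_; _<?_)
open import Data.Product.Base using (_×_; _,_)
open import Data.Tree.Binary using (Tree; leaf; node)
open import Data.Unit.Base using (⊤; tt)
open import Function.Base using (flip)
open import Relation.Binary.Core using (Rel; _⇒_)
open import Relation.Nullary.Decidable.Core using (does)
open import Level using (0ℓ)

-- The alphabet {a₁ < a₂ < ⋯} is ℕ with its usual order: the number i stands
-- for the letter aᵢ₊₁.
Letter : Set
Letter = ℕ

Word : Set
Word = List Letter

infix 4 _⟶_ _≡B_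

data _⟶_ : Rel Word 0ℓ where
  adj₁ : ∀ (u v : Word) {a b c d : Letter} → a ≤ b → b < c → c ≤ d →
         c ∷ u ++ a ∷ d ∷ v ++ [ b ] ⟶ c ∷ u ++ d ∷ a ∷ v ++ [ b ]
  adj₂ : ∀ (u v : Word) {a b c d : Letter} → a < b → b ≤ c → c < d →
         b ∷ u ++ d ∷ a ∷ v ++ [ c ] ⟶ b ∷ u ++ a ∷ d ∷ v ++ [ c ]

data _≡B_ : Rel Word 0ℓ where
  gen   : ∀ {u v} → u ⟶ v → u ≡B v
  refl  : ∀ {u} → u ≡B u
  sym   : ∀ {u v} → u ≡B v → v ≡B u
  trans : ∀ {u v w} → u ≡B v → v ≡B w → u ≡B w
  cong  : Congruent₂ _≡B_ _++_

-- A congruence on the free monoid is exactly a relation making (Word, _++_) a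
-- magma; the next two facts say that _≡B_ is the smallest one containing _⟶_.
≡B-isCongruence : IsMagma _≡B_ _++_
≡B-isCongruence = record
  { isEquivalence = record { refl = refl ; sym = sym ; trans = trans }
  ; ∙-cong        = cong
  }

≡B-smallest : ∀ {ℓ} {_∼_ : Rel Word ℓ} →
              IsMagma _∼_ _++_ → _⟶_ ⇒ _∼_ → _≡B_ ⇒ _∼_
≡B-smallest C inc (gen s)     = inc s
≡B-smallest C inc refl        = IsMagma.refl C
≡B-smallest C inc (sym p)     = IsMagma.sym C (≡B-smallest C inc p)
≡B-smallest C inc (trans p q) =
  IsMagma.trans C (≡B-smallest C inc p) (≡B-smallest C inc q)
≡B-smallest C inc (cong p q)  =
  IsMagma.∙-cong C (≡B-smallest C inc p) (≡B-smallest C inc q)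

LabeledTree : Set
LabeledTree = Tree Letter ⊤

-- Leaf insertion is defined on all labeled trees; it is only ever applied to
-- binary search trees of the matching kind.
insertLeft : Letter → LabeledTree → LabeledTree
insertLeft a (leaf _)     = node (leaf tt) a (leaf tt)
insertLeft a (node l b r) =
  if does (a <? b) then node (insertLeft a l) b r
                   else node l b (insertLeft a r)

insertRight : Letter → LabeledTree → LabeledTree
insertRight a (leaf _)     = node (leaf tt) a (leaf tt)
insertRight a (node l b r) =
  if does (a ≤? b) then node (insertRight a l) b r
                   else node l b (insertRight a r)

-- foldl inserts the first letter of the word first, foldr the last one.
P : Word → LabeledTree × LabeledTree
P u = foldl (flip insertLeft) (leaf tt) u , foldr insertRight (leaf tt) u

{-# OPTIONS --safe #-}

-- Two letters inserted one after the other may be exchanged as soon as their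
-- search paths in the tree diverge.  Letters a and d do so in the left (right)
-- tree exactly when an earlier (later) letter separates them, and the Baxter
-- relations exchange adjacent letters for which both happen.
--
-- Conversely, let w x u and w v have the same P-symbol, and write v = v₁ x v₂
-- with x not in v₁.  Inserting into the left tree of w, the letter x of x u is
-- the first to reach its leaf, so every letter of v₁ goes to another one.  In
-- the right tree of x u the node of this x has no child, so no letter of v₁ is
-- inserted below x in the right tree of v.  Hence x commutes to the left past
-- v₁, and one continues with w x, u and v₁ v₂.

module Submission where

open import Defs hiding (refl; sym; trans; cong)
open import Algebra.Structures using (IsMagma)
open import Data.Bool.Base using (Bool; true; false; if_then_else_)
import Data.Bool.Properties as Bool
open import Data.List.Base using ([]; _∷_; _++_; _∷ʳ_; [_]; foldl; foldr; filter)
open import Data.List.Properties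
  using (foldl-++; foldr-++; foldl-cong; foldr-cong; filter-++;
         ++-assoc; ∷ʳ-++)
open import Data.List.Membership.Propositional using (find)
open import Data.List.Membership.Propositional.Properties using (∈-∃++)
open import Data.List.Relation.Unary.All as All using (All; []; _∷_)
open import Data.List.Relation.Unary.All.Properties
  using (all-filter; filter⁺; filter⁻)
open import Data.List.Relation.Unary.Any using (Any; here; there)
open import Data.List.Relation.Unary.First as First using (first)
open import Data.List.Relation.Unary.First.Properties using (toView)
open import Data.Nat.Base using (_≤_; _<_)
open import Data.Nat.Properties
  using (_≟_; _≤?_; _<?_; <-trans; ≤-trans; ≮⇒≥; ≰⇒>; ≤-<-trans; <-≤-trans; <⇒≤;
         <-irrefl; <-asym; ≤-<-connex)
open import Data.Product.Base using (_×_; _,_; proj₁; proj₂)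
open import Data.Product.Properties using (,-injective)
open import Data.Sum.Base as Sum using (_⊎_; inj₁; inj₂)
open import Data.Tree.Binary using (leaf; node)
import Data.Tree.Binary.Relation.Unary.All as Tree
open import Data.Unit.Base using (tt)
open import Function.Base using (flip; _∘_)
open import Function.Bundles using (_⇔_; mk⇔)
open import Level using (0ℓ)
open import Relation.Binary.Core using (Rel)
open import Relation.Binary.Definitions using (Decidable; Transitive)
open import Relation.Binary.PropositionalEquality
  using (_≡_; _≢_; refl; sym; trans; cong; cong₂; subst; subst₂; module ≡-Reasoning)
open import Relation.Nullary
  using (¬_; does; yes; no; contradiction; ¬?)
open import Relation.Nullary.Decidable using (dec-true; dec-false; toSum)
open import Relation.Unary using (U)

node-injective : ∀ {l l′ r r′ : LabeledTree} {b b′} →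
                 node l b r ≡ node l′ b′ r′ → l ≡ l′ × b ≡ b′ × r ≡ r′
node-injective refl = refl , refl , refl

foldr-injective : ∀ {a b} {A : Set a} {B : Set b} {f : A → B → B} →
                  (∀ x {s t} → f x s ≡ f x t → s ≡ t) →
                  ∀ xs {s t} → foldr f s xs ≡ foldr f t xs → s ≡ t
foldr-injective f-inj []       eq = eq
foldr-injective f-inj (x ∷ xs) eq = foldr-injective f-inj xs (f-inj x eq)

-- One development serves both trees: `≺` becomes `<` for the left tree and `≤` for the right one.
-- `≺-cotrans` is the mixed transitivity obtained by reading `¬ a ≺ b` as the reverse comparison.
module Insertion
  (_≺_ : Rel Letter 0ℓ) (_≺?_ : Decidable _≺_)
  (≺-trans : Transitive _≺_)
  (≺-cotrans : ∀ {a b c} → a ≺ c → ¬ a ≺ b → b ≺ c)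
  where

  infix 6 _⊲_

  _⊲_ : Letter → Letter → Bool
  a ⊲ b = does (a ≺? b)

  insert : Letter → LabeledTree → LabeledTree
  insert a (leaf _)     = node (leaf tt) a (leaf tt)
  insert a (node l b r) =
    if a ⊲ b then node (insert a l) b r else node l b (insert a r)

  ⊲-split : ∀ {x y c} → x ⊲ c ≢ y ⊲ c → (x ≺ c × ¬ y ≺ c) ⊎ (y ≺ c × ¬ x ≺ c)
  ⊲-split {x} {y} {c} x≢y with x ≺? c | y ≺? c
  ... | yes p | yes q = contradiction refl x≢y
  ... | yes p | no q  = inj₁ (p , q)
  ... | no p  | yes q = inj₂ (q , p)
  ... | no p  | no q  = contradiction refl x≢y

  -- The letter `c` lies between `x` and `y`, and the test against `b` is monotone, so `c` follows
  -- `x` and `y` whenever these agree.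
  ⊲-convex′ : ∀ {x y c b} → x ≺ c → ¬ y ≺ c → x ⊲ b ≡ y ⊲ b → c ⊲ b ≡ y ⊲ b
  ⊲-convex′ {x} {y} {c} {b} x≺c y⊀c e with x ≺? b | y ≺? b
  ... | yes p | yes q = dec-true (c ≺? b) (≺-cotrans q y⊀c)
  ... | no p  | no q  = dec-false (c ≺? b) (p ∘ ≺-trans x≺c)

  ⊲-convex : ∀ {x y c b} → x ⊲ c ≢ y ⊲ c → x ⊲ b ≡ y ⊲ b → c ⊲ b ≡ y ⊲ b
  ⊲-convex x≢y e with ⊲-split x≢y
  ... | inj₁ (p , q) = ⊲-convex′ p q e
  ... | inj₂ (p , q) = trans (⊲-convex′ p q (sym e)) e

  -- Diverging search paths.

  -- A proof locates the node where the search paths of `x` and `y` part. Equations on the Boolean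
  -- tests let `insert` compute by rewriting.
  data Separated (x y : Letter) : LabeledTree → Set where
    here    : ∀ {l b r} → x ⊲ b ≢ y ⊲ b → Separated x y (node l b r)
    inLeft  : ∀ {l b r} → x ⊲ b ≡ true → y ⊲ b ≡ true →
              Separated x y l → Separated x y (node l b r)
    inRight : ∀ {l b r} → x ⊲ b ≡ false → y ⊲ b ≡ false →
              Separated x y r → Separated x y (node l b r)

  -- At the parting node the two letters enter different subtrees; above it they descend together.
  insert-comm : ∀ {x y t} → Separated x y t →
                insert x (insert y t) ≡ insert y (insert x t)
  insert-comm {x} {y} (here {b = b} x≢y) with x ⊲ b in ex | y ⊲ b in ey
  ... | true  | true  = contradiction refl x≢y
  ... | true  | false rewrite ex | ey = refl
  ... | false | true  rewrite ex | ey = refl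
  ... | false | false = contradiction refl x≢y
  insert-comm (inLeft {b = b} {r} ex ey s) rewrite ex | ey | ex =
    cong (λ t → node t b r) (insert-comm s)
  insert-comm (inRight {l} {b} ex ey s) rewrite ex | ey | ex =
    cong (node l b) (insert-comm s)

  separated-insert : ∀ {x y} c {t} → Separated x y t → Separated x y (insert c t)
  separated-insert c (here {b = b} x≢y) with c ⊲ b
  ... | true  = here x≢y
  ... | false = here x≢y
  separated-insert c (inLeft {b = b} ex ey s) with c ⊲ b
  ... | true  = inLeft ex ey (separated-insert c s)
  ... | false = inLeft ex ey s
  separated-insert c (inRight {b = b} ex ey s) with c ⊲ b
  ... | true  = inRight ex ey s
  ... | false = inRight ex ey (separated-insert c s)

  -- Either `x` and `y` part at an old node or, by `⊲-convex`, they travel with `c` to its new node,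
  -- where `c` itself parts them.
  insert-separates : ∀ {x y c} → x ⊲ c ≢ y ⊲ c → ∀ t → Separated x y (insert c t)
  insert-separates x≢y (leaf _) = here x≢y
  insert-separates {x} {y} {c} x≢y (node l b r) with x ⊲ b Bool.≟ y ⊲ b
  ... | no x≢y′ with c ⊲ b
  ...   | true  = here x≢y′
  ...   | false = here x≢y′
  insert-separates {x} {y} {c} x≢y (node l b r) | yes e
    rewrite ⊲-convex x≢y e with y ⊲ b in ey
  ...   | true  = inLeft e ey (insert-separates x≢y l)
  ...   | false = inRight e ey (insert-separates x≢y r)

  -- Insertion creates a single node, labeled `c`; a parting anywhere else was already present in
  -- `t`.
  separated-insert⁻ : ∀ {x y} c t → Separated x y (insert c t) →
                      x ⊲ c ≢ y ⊲ c ⊎ Separated x y t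
  separated-insert⁻ c (leaf _) (here x≢y) = inj₁ x≢y
  separated-insert⁻ c (node l b r) s with c ⊲ b
  separated-insert⁻ c (node l b r) (here x≢y) | true = inj₂ (here x≢y)
  separated-insert⁻ c (node l b r) (inLeft ex ey s) | true =
    Sum.map₂ (inLeft ex ey) (separated-insert⁻ c l s)
  separated-insert⁻ c (node l b r) (inRight ex ey s) | true =
    inj₂ (inRight ex ey s)
  separated-insert⁻ c (node l b r) (here x≢y) | false = inj₂ (here x≢y)
  separated-insert⁻ c (node l b r) (inLeft ex ey s) | false =
    inj₂ (inLeft ex ey s)
  separated-insert⁻ c (node l b r) (inRight ex ey s) | false =
    Sum.map₂ (inRight ex ey) (separated-insert⁻ c r s)

  Separates : Letter → Letter → Letter → Set
  Separates x y c = x ⊲ c ≢ y ⊲ c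

  separated-foldr⁻ : ∀ {x y} w → Separated x y (foldr insert (leaf tt) w) →
                     Any (Separates x y) w
  separated-foldr⁻ (c ∷ w) s with separated-insert⁻ c (foldr insert (leaf tt) w) s
  ... | inj₁ x≢y = here x≢y
  ... | inj₂ s′  = there (separated-foldr⁻ w s′)

  separated-foldl⁻ : ∀ {x y} t w → Separated x y (foldl (flip insert) t w) →
                     Separated x y t ⊎ Any (Separates x y) w
  separated-foldl⁻ t []      s = inj₁ s
  separated-foldl⁻ t (c ∷ w) s with separated-foldl⁻ (insert c t) w s
  ... | inj₂ any = inj₂ (there any)
  ... | inj₁ s′  with separated-insert⁻ c t s′
  ...   | inj₁ x≢y = inj₂ (here x≢y)
  ...   | inj₂ s″  = inj₁ s″

  separated-foldr : ∀ {x y t} w → Separated x y t →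
                    Separated x y (foldr insert t w)
  separated-foldr []      s = s
  separated-foldr (c ∷ w) s = separated-insert c (separated-foldr w s)

  separated-foldl : ∀ {x y t} w → Separated x y t →
                    Separated x y (foldl (flip insert) t w)
  separated-foldl []      s = s
  separated-foldl (c ∷ w) s = separated-foldl w (separated-insert c s)

  -- Cancellation of insertions.

  insert≢leaf : ∀ x t → insert x t ≢ leaf tt
  insert≢leaf x (node l b r) eq with x ⊲ b
  insert≢leaf x (node l b r) () | true
  insert≢leaf x (node l b r) () | false

  foldr-insert≡leaf : ∀ {t} w → foldr insert t w ≡ leaf tt → w ≡ []
  foldr-insert≡leaf         []      eq = refl
  foldr-insert≡leaf {t = t} (x ∷ w) eq =
    contradiction eq (insert≢leaf x (foldr insert t w))

  foldr-insert≢leaf : ∀ x t w → foldr insert (insert x t) w ≢ leaf tt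
  foldr-insert≢leaf x t w eq with refl ← foldr-insert≡leaf w eq = insert≢leaf x t eq

  singleton≢insert-node : ∀ x {l b r} →
                 node (leaf tt) x (leaf tt) ≢ insert x (node l b r)
  singleton≢insert-node x {l} {b} {r} eq with x ⊲ b
  ... | true  = insert≢leaf x l (sym (proj₁ (node-injective eq)))
  ... | false = insert≢leaf x r (sym (proj₂ (proj₂ (node-injective eq))))

  -- An existing root is kept and dictates the side of descent, and it gains a non-empty child,
  -- which a fresh node lacks. This serves to undo the last insertions in the right tree.
  insert-injective : ∀ x {s t} → insert x s ≡ insert x t → s ≡ t
  insert-injective x {leaf _}     {leaf _}       eq = refl
  insert-injective x {leaf _}     {node _ _ _}   eq = contradiction eq (singleton≢insert-node x)
  insert-injective x {node _ _ _} {leaf _}       eq = contradiction (sym eq) (singleton≢insert-node x)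
  insert-injective x {node l b r} {node l′ b′ r′} eq
    with x ⊲ b in e | x ⊲ b′ in e′
  ... | true | true with el , refl , refl ← node-injective eq =
    cong (λ t → node t b r) (insert-injective x el)
  ... | false | false with refl , refl , er ← node-injective eq =
    cong (node l b) (insert-injective x er)
  ... | true | false with _ , refl , _ ← node-injective eq =
    contradiction (trans (sym e) e′) λ ()
  ... | false | true with _ , refl , _ ← node-injective eq =
    contradiction (trans (sym e′) e) λ ()

  -- Splitting words at the root of a tree.

  _⊀?_ : Decidable (λ a b → ¬ a ≺ b)
  a ⊀? b = ¬? (a ≺? b)

  below above : Letter → Word → Word
  below b = filter (_≺? b)
  above b = filter (_⊀? b)

  -- The root sends each letter to one side and the sides evolve independently, so an equation
  -- between trees passes to subtrees by filtering the words.
  foldr-insert-node : ∀ {l b r} w → foldr insert (node l b r) w ≡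
    node (foldr insert l (below b w)) b (foldr insert r (above b w))
  foldr-insert-node []      = refl
  foldr-insert-node {l} {b} {r} (x ∷ w)
    rewrite foldr-insert-node {l} {b} {r} w with x ⊲ b
  ... | true  = refl
  ... | false = refl

  foldl-insert-node : ∀ {l b r} w → foldl (flip insert) (node l b r) w ≡
    node (foldl (flip insert) l (below b w)) b (foldl (flip insert) r (above b w))
  foldl-insert-node []      = refl
  foldl-insert-node {l} {b} {r} (x ∷ w) with x ⊲ b
  ... | true  = foldl-insert-node w
  ... | false = foldl-insert-node w

  Avoids : Letter → LabeledTree → Set
  Avoids x = Tree.All (_≢ x) U

  ¬avoids-insert : ∀ x t → ¬ Avoids x (insert x t)
  ¬avoids-insert x (leaf _)     (Tree.node _ x≢x _) = x≢x refl
  ¬avoids-insert x (node l b r) a with x ⊲ b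
  ¬avoids-insert x (node l b r) (Tree.node a _ _) | true  = ¬avoids-insert x l a
  ¬avoids-insert x (node l b r) (Tree.node _ _ a) | false = ¬avoids-insert x r a

  avoids-insert : ∀ {x y t} → y ≢ x → Avoids x t → Avoids x (insert y t)
  avoids-insert y≢x (Tree.leaf _) = Tree.node (Tree.leaf _) y≢x (Tree.leaf _)
  avoids-insert {y = y} y≢x (Tree.node {m = b} al b≢x ar) with y ⊲ b
  ... | true  = Tree.node (avoids-insert y≢x al) b≢x ar
  ... | false = Tree.node al b≢x (avoids-insert y≢x ar)

  avoids-foldr : ∀ {x w} → All (_≢ x) w → Avoids x (foldr insert (leaf tt) w)
  avoids-foldr []          = Tree.leaf _
  avoids-foldr (y≢x ∷ w≢x) = avoids-insert y≢x (avoids-foldr w≢x)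

  -- Separation deduced from equal trees.

  ⊲⇒true : ∀ {b} {ys : Word} → All (_≺ b) ys → All (λ y → y ⊲ b ≡ true) ys
  ⊲⇒true = All.map (dec-true (_ ≺? _))

  ⊲⇒false : ∀ {b} {ys : Word} → All (λ y → ¬ y ≺ b) ys → All (λ y → y ⊲ b ≡ false) ys
  ⊲⇒false = All.map (dec-false (_ ≺? _))

  -- Letters of `w` outside `below b w` part from `x` at the root; the others follow `x` into `l`.
  separated-node-left : ∀ {x l b r} w → x ⊲ b ≡ true →
    All (λ y → Separated y x l) (below b w) →
    All (λ y → Separated y x (node l b r)) w
  separated-node-left {b = b} w ex s = filter⁻ (_≺? b)
    (All.zipWith (λ { (ey , s) → inLeft ey ex s }) (⊲⇒true (all-filter (_≺? b) w) , s))
    (All.map (λ ey → here λ e → contradiction (trans (sym ey) (trans e ex)) λ ())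
             (⊲⇒false (all-filter (_⊀? b) w)))

  separated-node-right : ∀ {x l b r} w → x ⊲ b ≡ false →
    All (λ y → Separated y x r) (above b w) →
    All (λ y → Separated y x (node l b r)) w
  separated-node-right {b = b} w ex s = filter⁻ (_≺? b)
    (All.map (λ ey → here λ e → contradiction (trans (sym ey) (trans e ex)) λ ())
             (⊲⇒true (all-filter (_≺? b) w)))
    (All.zipWith (λ { (ey , s) → inRight ey ex s }) (⊲⇒false (all-filter (_⊀? b) w) , s))

  -- The right-hand side says that x labels a leaf, so that no letter of w has
  -- been inserted below x.
  separated-of-leaf : ∀ {x} s t w → All (_≢ x) w →
    foldr insert (insert x s) w ≡ insert x t → All (λ y → Separated y x s) w
  -- Here `x` is a childless root on the right, so both filtered parts of `w` are empty.
  separated-of-leaf {x} (leaf _) (leaf _) w w≢x eq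
    with el , _ , er ← node-injective (trans (sym (foldr-insert-node w)) eq) =
    filter⁻ (_≺? x)
      (subst (All _) (sym (foldr-insert≡leaf (below x w) el)) [])
      (subst (All _) (sym (foldr-insert≡leaf (above x w) er)) [])
  -- On the right `x` occurs strictly below the root, where the left-hand tree holds only letters of
  -- `w`.
  separated-of-leaf {x} (leaf _) (node l b r) w w≢x eq with x ⊲ b
  ... | true  with el , _ , _ ← node-injective (trans (sym (foldr-insert-node w)) eq) =
    contradiction (subst (Avoids x) el (avoids-foldr (filter⁺ (_≺? x) w≢x)))
                  (¬avoids-insert x l)
  ... | false with _ , _ , er ← node-injective (trans (sym (foldr-insert-node w)) eq) =
    contradiction (subst (Avoids x) er (avoids-foldr (filter⁺ (_⊀? x) w≢x)))
                  (¬avoids-insert x r)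
  -- On the left the inserted `x` gives the root a child; on the right the root has none.
  separated-of-leaf {x} (node l b r) (leaf _) w w≢x eq with x ⊲ b
  ... | true  with el , _ , _ ← node-injective (trans (sym (foldr-insert-node w)) eq) =
    contradiction el (foldr-insert≢leaf x l (below b w))
  ... | false with _ , _ , er ← node-injective (trans (sym (foldr-insert-node w)) eq) =
    contradiction er (foldr-insert≢leaf x r (above b w))
  separated-of-leaf {x} (node l b r) (node l′ b′ r′) w w≢x eq
    with x ⊲ b in e | x ⊲ b′ in e′
  ... | true | true
    with el , _ , _ ← node-injective (trans (sym (foldr-insert-node w)) eq) =
    separated-node-left w e
      (separated-of-leaf l l′ (below b w) (filter⁺ (_≺? b) w≢x) el)
  ... | false | false
    with _ , _ , er ← node-injective (trans (sym (foldr-insert-node w)) eq) =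
    separated-node-right w e
      (separated-of-leaf r r′ (above b w) (filter⁺ (_⊀? b) w≢x) er)
  ... | true | false
    with _ , refl , _ ← node-injective (trans (sym (foldr-insert-node w)) eq) =
    contradiction (trans (sym e) e′) λ ()
  ... | false | true
    with _ , refl , _ ← node-injective (trans (sym (foldr-insert-node w)) eq) =
    contradiction (trans (sym e′) e) λ ()

  -- Induction on `t`. At a leaf the first letter of each word becomes the root, so `v` must be
  -- empty. At a node both words are filtered to the side that `x` enters, and the other letters of
  -- `v` part from `x` at the root.
  separated-of-first : ∀ {x} t u v w → All (_≢ x) v →
    foldl (flip insert) t (x ∷ u) ≡ foldl (flip insert) t (v ++ x ∷ w) →
    All (λ y → Separated y x t) v
  separated-of-first (leaf _) u []      w v≢x eq = []
  separated-of-first (leaf _) u (y ∷ v) w (y≢x ∷ _) eq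
    with _ , x≡y , _ ← node-injective (trans (sym (foldl-insert-node u))
                          (trans eq (foldl-insert-node (v ++ _ ∷ w)))) =
    contradiction (sym x≡y) y≢x
  separated-of-first {x} (node l b r) u v w v≢x eq
    with eqs ← node-injective (trans (sym (foldl-insert-node (x ∷ u)))
                                     (trans eq (foldl-insert-node (v ++ x ∷ w))))
    -- Splitting the filters before testing `x` keeps the shape `v ++ x ∷ w` on the side where `x`
    -- goes.
    rewrite filter-++ (_≺? b) v (x ∷ w) | filter-++ (_⊀? b) v (x ∷ w)
    with x ⊲ b in e
  ... | true  = separated-node-left v e
    (separated-of-first l (below b u) (below b v) (below b w) (filter⁺ (_≺? b) v≢x) (proj₁ eqs))
  ... | false = separated-node-right v e
    (separated-of-first r (above b u) (above b v) (above b w) (filter⁺ (_⊀? b) v≢x)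
      (proj₂ (proj₂ eqs)))

-- The left and right trees of a word.

module L = Insertion _<_ _<?_ <-trans (λ a<c a≮b → ≤-<-trans (≮⇒≥ a≮b) a<c)
module R = Insertion _≤_ _≤?_ ≤-trans (λ a≤c a≰b → <⇒≤ (<-≤-trans (≰⇒> a≰b) a≤c))

insertLeft≗ : ∀ a t → insertLeft a t ≡ L.insert a t
insertLeft≗ a (leaf _)     = refl
insertLeft≗ a (node l b r) =
  cong₂ (λ l′ r′ → if does (a <? b) then node l′ b r else node l b r′)
        (insertLeft≗ a l) (insertLeft≗ a r)

insertRight≗ : ∀ a t → insertRight a t ≡ R.insert a t
insertRight≗ a (leaf _)     = refl
insertRight≗ a (node l b r) =
  cong₂ (λ l′ r′ → if does (a ≤? b) then node l′ b r else node l b r′)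
        (insertRight≗ a l) (insertRight≗ a r)

foldL foldR : LabeledTree → Word → LabeledTree
foldL = foldl (flip L.insert)
foldR = foldr R.insert

foldL-++ : ∀ t u v → foldL t (u ++ v) ≡ foldL (foldL t u) v
foldL-++ = foldl-++ (flip L.insert)

foldR-++ : ∀ t u v → foldR t (u ++ v) ≡ foldR (foldR t v) u
foldR-++ = foldr-++ R.insert

treeL treeR : Word → LabeledTree
treeL = foldL (leaf tt)
treeR = foldR (leaf tt)

P≗ : ∀ u → P u ≡ (treeL u , treeR u)
P≗ u = cong₂ _,_ (foldl-cong (λ t a → insertLeft≗ a t) _ u)
                 (foldr-cong insertRight≗ refl u)

-- Congruent words have equal P-symbols.

infix 4 _∼_

-- Equality of P-symbols, strengthened to arbitrary initial trees so that it is
-- compatible with concatenation on both sides.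
_∼_ : Rel Word 0ℓ
u ∼ v = (∀ t → foldL t u ≡ foldL t v) × (∀ t → foldR t u ≡ foldR t v)

∼-isCongruence : IsMagma _∼_ _++_
∼-isCongruence = record
  { isEquivalence = record
    { refl  = (λ _ → refl) , (λ _ → refl)
    ; sym   = λ (l , r) → (λ t → sym (l t)) , (λ t → sym (r t))
    ; trans = λ (l , r) (l′ , r′) →
        (λ t → trans (l t) (l′ t)) , (λ t → trans (r t) (r′ t))
    }
  ; ∙-cong = λ {u} {u′} {v} {v′} (l , r) (l′ , r′) →
      (λ t → trans (foldL-++ t u v) (trans (l′ _) (trans
               (cong (λ s → foldL s v′) (l t)) (sym (foldL-++ t u′ v′)))))
    , (λ t → trans (foldR-++ t u v) (trans (r _) (trans
               (cong (λ s → foldR s u′) (r′ t)) (sym (foldR-++ t u′ v′)))))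
  }

-- The letter `c` enters the left tree before `x` and `y`, and `b` enters the right tree before
-- them. Separation survives the insertion of `u` and `v` in between, so the two insertions commute.
exchange-∼ : ∀ {x y b c} u v → L.Separates x y c → R.Separates x y b →
  c ∷ u ++ x ∷ y ∷ v ++ [ b ] ∼ c ∷ u ++ y ∷ x ∷ v ++ [ b ]
exchange-∼ {x} {y} {b} {c} u v x≢y x≢y′ = exchangeL , exchangeR
  where
  exchangeL : ∀ t → foldL t (c ∷ u ++ x ∷ y ∷ v ++ [ b ]) ≡
                    foldL t (c ∷ u ++ y ∷ x ∷ v ++ [ b ])
  exchangeL t = trans (foldL-++ (L.insert c t) u _) (trans
    (cong (λ s → foldL s (v ++ [ b ]))
      (sym (L.insert-comm (L.separated-foldl u (L.insert-separates x≢y t)))))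
    (sym (foldL-++ (L.insert c t) u _)))

  exchangeR : ∀ t → foldR t (c ∷ u ++ x ∷ y ∷ v ++ [ b ]) ≡
                    foldR t (c ∷ u ++ y ∷ x ∷ v ++ [ b ])
  exchangeR t = cong (R.insert c) (trans (foldR-++ t u _) (trans
    (cong (λ s → foldR s u) (R.insert-comm
      (subst (R.Separated x y) (sym (foldR-++ t v [ b ]))
        (R.separated-foldr v (R.insert-separates x≢y′ t)))))
    (sym (foldR-++ t u _))))

separatesL : ∀ {a c d} → a < c → c ≤ d → L.Separates a d c
separatesL {a} {c} {d} a<c c≤d e
  rewrite dec-true (a <? c) a<c | dec-false (d <? c) (λ d<c → <-irrefl refl (<-≤-trans d<c c≤d))
  = contradiction e λ ()

separatesR : ∀ {a b d} → a ≤ b → b < d → R.Separates a d b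
separatesR {a} {b} {d} a≤b b<d e
  rewrite dec-true (a ≤? b) a≤b | dec-false (d ≤? b) (λ d≤b → <-irrefl refl (<-≤-trans b<d d≤b))
  = contradiction e λ ()

⟶⇒∼ : ∀ {u v} → u ⟶ v → u ∼ v
⟶⇒∼ (adj₁ u v a≤b b<c c≤d) = exchange-∼ u v
  (separatesL (≤-<-trans a≤b b<c) c≤d) (separatesR a≤b (<-≤-trans b<c c≤d))
-- This relation lists the larger letter first, whence `sym`.
⟶⇒∼ (adj₂ u v a<b b≤c c<d) = exchange-∼ u v
  (separatesL a<b (<⇒≤ (≤-<-trans b≤c c<d)) ∘ sym)
  (separatesR (<⇒≤ (<-≤-trans a<b b≤c)) c<d ∘ sym)

≡B⇒∼ : ∀ {u v} → u ≡B v → u ∼ v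
≡B⇒∼ = ≡B-smallest ∼-isCongruence ⟶⇒∼

≡B⇒P≡ : ∀ {u v} → u ≡B v → P u ≡ P v
≡B⇒P≡ {u} {v} u≡v with l , r ← ≡B⇒∼ u≡v =
  trans (P≗ u) (trans (cong₂ _,_ (l _) (r _)) (sym (P≗ v)))

-- Equal P-symbols come from congruent words.

-- Comparing `c` with `b` decides which Baxter relation applies: `a < c ≤ b < d` is an instance of
-- `adj₂`, and `a ≤ b < c ≤ d` of `adj₁`.
exchange-sorted : ∀ u v {a b c d} → a < c → c ≤ d → a ≤ b → b < d →
  c ∷ u ++ a ∷ d ∷ v ++ [ b ] ≡B c ∷ u ++ d ∷ a ∷ v ++ [ b ]
exchange-sorted u v {a} {b} {c} a<c c≤d a≤b b<d with ≤-<-connex c b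
... | inj₁ c≤b = _≡B_.sym (gen (adj₂ u v a<c c≤b b<d))
... | inj₂ b<c = gen (adj₁ u v a≤b b<c c≤d)

exchange-≡B : ∀ {x y b c} u v → L.Separates x y c → R.Separates x y b →
  c ∷ u ++ x ∷ y ∷ v ++ [ b ] ≡B c ∷ u ++ y ∷ x ∷ v ++ [ b ]
exchange-≡B u v x≢y x≢y′ with L.⊲-split x≢y | R.⊲-split x≢y′
... | inj₁ (x<c , y≮c) | inj₁ (x≤b , y≰b) =
  exchange-sorted u v x<c (≮⇒≥ y≮c) x≤b (≰⇒> y≰b)
... | inj₂ (y<c , x≮c) | inj₂ (y≤b , x≰b) =
  _≡B_.sym (exchange-sorted u v y<c (≮⇒≥ x≮c) y≤b (≰⇒> x≰b))
-- The two separating letters cannot disagree on which of `x` and `y` is smaller.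
... | inj₁ (x<c , y≮c) | inj₂ (y≤b , x≰b) =
  contradiction (<-≤-trans x<c (≮⇒≥ y≮c)) (<-asym (≤-<-trans y≤b (≰⇒> x≰b)))
... | inj₂ (y<c , x≮c) | inj₁ (x≤b , y≰b) =
  contradiction (<-≤-trans y<c (≮⇒≥ x≮c)) (<-asym (≤-<-trans x≤b (≰⇒> y≰b)))

regroup : ∀ {c b : Letter} w u m v z →
  (w ++ c ∷ u) ++ m ++ v ++ b ∷ z ≡ w ++ (c ∷ u ++ m ++ v ++ [ b ]) ++ z
regroup {c} {b} w u m v z = begin
  (w ++ c ∷ u) ++ m ++ v ++ b ∷ z       ≡⟨ ++-assoc w (c ∷ u) _ ⟩
  w ++ c ∷ u ++ m ++ v ++ b ∷ z         ≡⟨ cong (λ s → w ++ c ∷ u ++ m ++ s) (∷ʳ-++ v b z) ⟨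
  w ++ c ∷ u ++ m ++ (v ++ [ b ]) ++ z  ≡⟨ cong (λ s → w ++ c ∷ u ++ s) (++-assoc m _ z) ⟨
  w ++ c ∷ u ++ (m ++ v ++ [ b ]) ++ z  ≡⟨ cong (w ++_) (++-assoc (c ∷ u) _ z) ⟨
  w ++ (c ∷ u ++ m ++ v ++ [ b ]) ++ z  ∎
  where open ≡-Reasoning

++-congˡ : ∀ w {u v} → u ≡B v → w ++ u ≡B w ++ v
++-congˡ w = _≡B_.cong (_≡B_.refl {w})

++-congʳ : ∀ {u v} z → u ≡B v → u ++ z ≡B v ++ z
++-congʳ z u≡v = _≡B_.cong u≡v (_≡B_.refl {z})

swap : ∀ {x y} w z → L.Separated x y (treeL w) → R.Separated x y (treeR z) →
       w ++ x ∷ y ∷ z ≡B w ++ y ∷ x ∷ z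
swap {x} {y} w z sl sr with L.separated-foldl⁻ (leaf tt) w sl | R.separated-foldr⁻ z sr
-- The absent case `inj₁` would be a parting in the empty tree. The separating letters found in `w`
-- and `z` delimit the factor to be rewritten.
... | inj₂ anyL | anyR
  with c , c∈w , x≢y ← find anyL | b , b∈z , x≢y′ ← find anyR
  with w′ , u , refl ← ∈-∃++ c∈w | v , z′ , refl ← ∈-∃++ b∈z =
  subst₂ _≡B_
    (sym (regroup w′ u (x ∷ y ∷ []) v z′))
    (sym (regroup w′ u (y ∷ x ∷ []) v z′))
    (++-congˡ w′ (++-congʳ z′ (exchange-≡B u v x≢y x≢y′)))

-- The letter `x` passes the last letter of `v` first. Separation is assumed only for the trees of
-- `w` and `z`, and persists as letters of `v` are added to either.
moveToFront : ∀ {x} w v z →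
  All (λ y → L.Separated y x (treeL w)) v → All (λ y → R.Separated y x (treeR z)) v →
  w ++ v ++ x ∷ z ≡B w ++ x ∷ v ++ z
moveToFront w [] z sl sr = _≡B_.refl
moveToFront {x} w (y ∷ v) z (syl ∷ sl) (syr ∷ sr) = _≡B_.trans
  (subst₂ _≡B_ (∷ʳ-++ w y _) (∷ʳ-++ w y _) (moveToFront (w ∷ʳ y) v z (All.map grow sl) sr))
  (swap w (v ++ z) syl
    (subst (R.Separated y x) (sym (foldR-++ _ v z)) (R.separated-foldr v syr)))
  where
  grow : ∀ {y′} → L.Separated y′ x (treeL w) → L.Separated y′ x (treeL (w ∷ʳ y))
  grow {y′} s = subst (L.Separated y′ x) (sym (foldL-++ _ w [ y ])) (L.separated-insert y s)

-- Induction on `u`, with `w` the prefix already matched. The hypothesis concerns whole words, so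
-- that `≡B⇒P≡` can carry it across a rearrangement of `v`.
P≡⇒≡B-from : ∀ w u v → P (w ++ u) ≡ P (w ++ v) → w ++ u ≡B w ++ v
P≡⇒≡B-from w u v eq
  with eqL , eqR ← ,-injective (trans (sym (P≗ (w ++ u))) (trans eq (P≗ (w ++ v))))
  -- In the left tree `w` comes first and merely supplies the initial tree; in the right tree it
  -- comes last and is cancelled by injectivity.
  with eqL ← trans (sym (foldL-++ _ w u)) (trans eqL (foldL-++ _ w v))
     | eqR ← foldr-injective R.insert-injective w
               (trans (sym (foldR-++ _ w u)) (trans eqR (foldR-++ _ w v)))
  = go u eq eqL eqR
  where
  go : ∀ u → P (w ++ u) ≡ P (w ++ v) → foldL (treeL w) u ≡ foldL (treeL w) v →
       treeR u ≡ treeR v → w ++ u ≡B w ++ v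
  go [] _ _ eqR with refl ← R.foldr-insert≡leaf v (sym eqR) = _≡B_.refl
  go (x ∷ u) eq eqL eqR with first (λ y → Sum.swap (toSum (y ≟ x))) v
  -- The right tree of `x ∷ u` contains `x`, hence so does `v`.
  ... | inj₂ v≢x =
    contradiction (subst (R.Avoids x) (sym eqR) (R.avoids-foldr v≢x))
                  (R.¬avoids-insert x (treeR u))
  ... | inj₁ x∈v with toView x∈v
  ...   | First._++_∷_ {v₁} v₁≢x refl v₂ =
    _≡B_.trans
      (subst₂ _≡B_ (∷ʳ-++ w x _) (∷ʳ-++ w x _)
        (P≡⇒≡B-from (w ∷ʳ x) u (v₁ ++ v₂)
          (subst₂ (λ s t → P s ≡ P t) (sym (∷ʳ-++ w x _)) (sym (∷ʳ-++ w x _))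
            (trans eq (≡B⇒P≡ moved)))))
      (_≡B_.sym moved)
    where
    moved : w ++ v₁ ++ x ∷ v₂ ≡B w ++ x ∷ v₁ ++ v₂
    moved = moveToFront w v₁ v₂
      (L.separated-of-first (treeL w) u v₁ v₂ v₁≢x eqL)
      -- In the right tree of `x ∷ u` the letter `x` is inserted last, which makes its node
      -- childless.
      (R.separated-of-leaf (treeR v₂) (treeR u) v₁ v₁≢x
        (trans (sym (foldR-++ _ v₁ (x ∷ v₂))) (sym eqR)))

theorem4p6 : (u v : Word) → u ≡B v ⇔ P u ≡ P v
theorem4p6 u v = mk⇔ ≡B⇒P≡ (P≡⇒≡B-from [] u v)
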